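{- Let $w\in S_n$ be $k$-Grassmannian and let $P_w\in\mathcal{P}_{k,n}$ be the lattice path with $(P_w)_U=w([k])=\{w(1),\dots,w(k)\}$. Let $\mathbf{x_w}$ be a reduced word for $x_w$ and $\mathbf w$ a reduced word for $w$. Then $x_ww=\tau_{P_w}$, and the concatenation $\mathbf{x_w}\mathbf w$ is a reduced word for $\tau_{P_w}$, of length $k(n-k)$.
   Context: Let $n\ge2$, $0\le k\le n$. $\tilde S_n$ is the group of bijections $f:\mathbb{Z}\to\mathbb{Z}$ with $f(i+n)=f(i)+n$, with products read left to right, $(fg)(a)=g(f(a))$. $\tilde S_n^{(k)}$ is the subset with $\frac1n\sum_{i=1}^n(f(i)-i)=k$. Length: $\ell(f)=\#\{(a,b):1\le a\le n,\ b\in\mathbb{Z},\ a<b,\ f(a)>f(b)\}$. $s_i$ ($0\le i\le n-1$) exchanges $i+mn$ and $i+1+mn$ for all $m$ and fixes all other integers. $\Lambda(i)=i+1$. $S_n\subset\tilde S_n$ via periodic extension. A reduced word for $f\in\tilde S_n^{(k)}$ is a sequence $(s_{i_1},\dots,s_{i_m})$ with $s_{i_1}\cdots s_{i_m}=\Lambda^{ -k}f$ and $m=\ell(f)$ (for $w\in S_n$ this is with $k=0$, the usual notion). A permutation $w\in S_n$ is $k$-Grassmannian if $w(1)<\dots<w(k)$ and $w(k+1)<\dots<w(n)$. $\tau_{k,n}\in\tilde S_n^{(k)}$ is given by $\tau_{k,n}(i)=i+n$ for $1\le i\le k$ and $\tau_{k,n}(i)=i$ for $k+1\le i\le n$; $x_w:=w^{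 -1}\tau_{k,n}$. $\mathcal{P}_{k,n}$ is the set of lattice paths from $(0,0)$ to $(n-k,k)$ with $n$ unit right/up steps; $P_U\subset[n]$ is the set of indices of the up-steps of $P$. $\tau_P\in\tilde S_n^{(k)}$ is the affine permutation with $\tau_P(i)=i+n$ if $i\bmod n\in P_U$ and $\tau_P(i)=i$ otherwise (residues taken in $[n]$). -}

module Defs where

open import Algebra.Bundles using (module AbelianGroup)
import Algebra.Properties.Group as Group
import Algebra.Properties.CommutativeMonoid.Sum as Sum
open import Data.Bool.Base using (true; false; if_then_else_)
open import Data.Fin.Base as Fin using (Fin; toℕ; fromℕ<)
open import Data.Fin.Permutation as Perm using (Permutation′; _⟨$⟩ʳ_; _⟨$⟩ˡ_)
open import Data.Fin.Properties using (toℕ<n; toℕ-fromℕ<; toℕ-injective)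
open import Data.Integer.Base using (ℤ; +_; +≤+; +<+; 0ℤ; 1ℤ; -1ℤ; _+_; _-_; _*_; -_; _≤_; _<_; _>_)
open import Data.Integer.Divisibility.Signed using (_∣_; _∣?_; ∣⇒∣ᵤ; ∣m∣n⇒∣m-n; ∣-refl; ∣m∣n⇒∣m+n; ∣m+n∣n⇒∣m)
open import Data.Integer.DivMod using (_/ℕ_; _%ℕ_; n%ℕd<d; a≡a%ℕn+[a/ℕn]*n)
import Data.Integer.Properties as ℤ
open import Data.Integer.Tactic.RingSolver using (solve-∀)
open import Data.List.Base using (List; foldr; map; length)
open import Data.Nat.Base as ℕ using (ℕ; zero; suc; NonTrivial; NonZero; nonTrivial⇒nonZero; nonTrivial⇒≢1)
import Data.Nat.Divisibility as ℕ
import Data.Nat.Properties as ℕ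
open import Data.Product.Base using (_×_; _,_; proj₁; proj₂; ∃; ∃₂)
open import Data.Rational.Base as ℚ using (ℚ)
open import Data.Vec.Base using (Vec; []; _∷_; lookup; tabulate)
open import Data.Vec.Properties using (lookup∘tabulate)
open import Function.Base using (_∘_)
open import Function.Bundles using (_↔_; mk↔ₛ′; module Inverse)
open import Function.Construct.Composition using (_↔-∘_)
open import Function.Construct.Identity using (↔-id)
open import Function.Construct.Symmetry using (↔-sym)
open import Relation.Binary.Definitions using (tri<; tri≈; tri>)
open import Relation.Binary.PropositionalEquality using (_≡_; refl; sym; trans; cong; cong₂; subst; module ≡-Reasoning)
open import Relation.Nullary using (¬_; Dec; yes; no; does; contradiction)
open import Relation.Nullary.Decidable using (dec-true; dec-false)
open import Relation.Unary using (Pred; Decidable; _≐_)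
open import Level using (0ℓ)

private
  open module ℤSum = Sum ℤ.+-0-commutativeMonoid using (sum-syntax)
  open Group (AbelianGroup.group ℤ.+-0-abelianGroup) using (∙-cancelˡ; ∙-cancelʳ)
  module ℕSum = Sum ℕ.+-0-commutativeMonoid

record AffinePermutation (n : ℕ) : Set where
  field
    bijection : ℤ ↔ ℤ
  open Inverse bijection public using (to; from)
  field
    periodic  : ∀ i → to (i + + n) ≡ to i + + n

  to∘from : ∀ i → to (from i) ≡ i
  to∘from = Inverse.strictlyInverseˡ bijection

  from∘to : ∀ i → from (to i) ≡ i
  from∘to = Inverse.strictlyInverseʳ bijection

open AffinePermutation using (to)

infix  4 _≈_
infixl 7 _·_
infix  8 _⁻¹ _^_

_≈_ : ∀ {n} → AffinePermutation n → AffinePermutation n → Set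
f ≈ g = ∀ i → to f i ≡ to g i

ε : ∀ {n} → AffinePermutation n
ε = record { bijection = ↔-id ℤ ; periodic = λ _ → refl }

-- Products are read left to right: to (f · g) a ≡ to g (to f a).
_·_ : ∀ {n} → AffinePermutation n → AffinePermutation n → AffinePermutation n
f · g = record
  { bijection = g.bijection ↔-∘ f.bijection
  ; periodic  = λ i → trans (cong g.to (f.periodic i)) (g.periodic (f.to i))
  }
  where
  module f = AffinePermutation f
  module g = AffinePermutation g

_⁻¹ : ∀ {n} → AffinePermutation n → AffinePermutation n
_⁻¹ {n} f = record { bijection = ↔-sym f.bijection ; periodic = periodic′ }
  where
  module f = AffinePermutation f
  open ≡-Reasoning
  periodic′ : ∀ i → f.from (i + + n) ≡ f.from i + + n
  periodic′ i = begin
    f.from (i + + n)                 ≡⟨ cong (λ j → f.from (j + + n)) (f.to∘from i) ⟨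
    f.from (f.to (f.from i) + + n)   ≡⟨ cong f.from (f.periodic (f.from i)) ⟨
    f.from (f.to (f.from i + + n))   ≡⟨ f.from∘to _ ⟩
    f.from i + + n                   ∎

_^_ : ∀ {n} → AffinePermutation n → ℕ → AffinePermutation n
f ^ zero  = ε
f ^ suc m = f · f ^ m

Λ : ∀ {n} → AffinePermutation n
Λ {n} = record
  { bijection = mk↔ₛ′ (_+ 1ℤ) (_- 1ℤ) (solve-∀) (solve-∀)
  ; periodic  = λ i → lem i (+ n)
  }
  where
  lem : ∀ i m → i + m + 1ℤ ≡ i + 1ℤ + m
  lem = solve-∀

-- The pairs counted by the length ℓ(f).  The components after a and b are
-- proof-irrelevant, so distinct elements are distinct pairs (a , b).
Inversion : ∀ {n} → AffinePermutation n → Set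
Inversion {n} f = ∃₂ λ a b → (1ℤ ≤ a × a ≤ + n) × a < b × to f a > to f b

-- ℓ(f) = m, as a statement about the cardinality of the set of inversions.
HasLength : ∀ {n} → AffinePermutation n → ℕ → Set
HasLength f m = Inversion f ↔ Fin m

-- The index i : Fin n stands for the element toℕ i + 1 of [n].

infix 8 [_]

[_] : ∀ {n} → Fin n → ℤ
[ i ] = + suc (toℕ i)

private
  div-unique-≤ : ∀ {n} (r r′ : Fin n) q q′ →
                 + toℕ r + q * + n ≡ + toℕ r′ + q′ * + n → q′ ≤ q
  div-unique-≤ {n} r r′ q q′ eq with ℤ.<-cmp q q′
  ... | tri≈ _ q≡q′ _ = ℤ.≤-reflexive (sym q≡q′)
  ... | tri> _ _ q′<q = ℤ.<⇒≤ q′<q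
  ... | tri< q<q′ _ _ = contradiction eq (ℤ.<⇒≢ (begin-strict
    + toℕ r + q * + n    <⟨ ℤ.+-monoˡ-< (q * + n) (+<+ (toℕ<n r)) ⟩
    + n + q * + n        ≡⟨ ℤ.suc-* q (+ n) ⟨
    (1ℤ + q) * + n       ≤⟨ ℤ.*-monoʳ-≤-nonNeg (+ n) (ℤ.i<j⇒suc[i]≤j q<q′) ⟩
    q′ * + n             ≤⟨ ℤ.i≤j+i (q′ * + n) (+ toℕ r′) ⟩
    + toℕ r′ + q′ * + n  ∎))
    where open ℤ.≤-Reasoning

  div-unique : ∀ {n} (r r′ : Fin n) q q′ →
               + toℕ r + q * + n ≡ + toℕ r′ + q′ * + n → r ≡ r′ × q ≡ q′
  div-unique {n} r r′ q q′ eq = r≡r′ , q≡q′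
    where
    q≡q′ : q ≡ q′
    q≡q′ = ℤ.≤-antisym (div-unique-≤ r′ r q′ q (sym eq)) (div-unique-≤ r r′ q q′ eq)
    r≡r′ : r ≡ r′
    r≡r′ = toℕ-injective (ℤ.+-injective
      (∙-cancelʳ (q * + n) _ _
        (trans eq (cong (λ p → + toℕ r′ + p * + n) (sym q≡q′)))))

module _ {n : ℕ} .{{_ : NonTrivial n}} where

  private instance
    nonZero : NonZero n
    nonZero = nonTrivial⇒nonZero n

  -- Every integer is [ residue a ] + quotient a * n in exactly one way.
  residue : ℤ → Fin n
  residue a = fromℕ< (n%ℕd<d (a - 1ℤ) n)

  quotient : ℤ → ℤ
  quotient a = (a - 1ℤ) /ℕ n

  [residue]+quotient : ∀ a → [ residue a ] + quotient a * + n ≡ a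
  [residue]+quotient a = begin
    [ residue a ] + quotient a * + n
      ≡⟨ cong (λ r → + suc r + quotient a * + n) (toℕ-fromℕ< (n%ℕd<d (a - 1ℤ) n)) ⟩
    (1ℤ + + ((a - 1ℤ) %ℕ n)) + quotient a * + n
      ≡⟨ ℤ.+-assoc 1ℤ (+ ((a - 1ℤ) %ℕ n)) (quotient a * + n) ⟩
    1ℤ + (+ ((a - 1ℤ) %ℕ n) + quotient a * + n)
      ≡⟨ cong (λ b → 1ℤ + b) (a≡a%ℕn+[a/ℕn]*n (a - 1ℤ) n) ⟨
    1ℤ + (a - 1ℤ)
      ≡⟨ lem a ⟩
    a ∎
    where
    open ≡-Reasoning
    lem : ∀ i → 1ℤ + (i - 1ℤ) ≡ i
    lem = solve-∀

  residue-quotient-unique : ∀ (r : Fin n) q {a} → [ r ] + q * + n ≡ a →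
                            residue a ≡ r × quotient a ≡ q
  residue-quotient-unique r q {a} eq = div-unique (residue a) r (quotient a) q
    (∙-cancelˡ 1ℤ _ _ (begin
      1ℤ + (+ toℕ (residue a) + quotient a * + n) ≡⟨ ℤ.+-assoc 1ℤ (+ toℕ (residue a)) (quotient a * + n) ⟨
      [ residue a ] + quotient a * + n            ≡⟨ [residue]+quotient a ⟩
      a                                           ≡⟨ eq ⟨
      [ r ] + q * + n                             ≡⟨ ℤ.+-assoc 1ℤ (+ toℕ r) (q * + n) ⟩
      1ℤ + (+ toℕ r + q * + n)                    ∎))
    where open ≡-Reasoning

  private
    shift-eq : ∀ a m → [ residue a ] + (quotient a + m) * + n ≡ a + m * + n
    shift-eq a m = trans (lem [ residue a ] (quotient a) m (+ n))
                         (cong (_+ m * + n) ([residue]+quotient a))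
      where
      lem : ∀ r q m n → r + (q + m) * n ≡ r + q * n + m * n
      lem = solve-∀

    +n-eq : ∀ a → [ residue a ] + (quotient a + 1ℤ) * + n ≡ a + + n
    +n-eq a = trans (shift-eq a 1ℤ) (cong (λ b → a + b) (ℤ.*-identityˡ (+ n)))

    -n-eq : ∀ a → [ residue a ] + (quotient a + -1ℤ) * + n ≡ a - + n
    -n-eq a = trans (shift-eq a -1ℤ) (cong (λ b → a + b) (ℤ.-1*i≡-i (+ n)))

  residue-+n : ∀ a → residue (a + + n) ≡ residue a
  residue-+n a = proj₁ (residue-quotient-unique (residue a) (quotient a + 1ℤ) (+n-eq a))

  residue--n : ∀ a → residue (a - + n) ≡ residue a
  residue--n a = proj₁ (residue-quotient-unique (residue a) (quotient a + -1ℤ) (-n-eq a))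

  quotient-+n : ∀ a → quotient (a + + n) ≡ quotient a + 1ℤ
  quotient-+n a = proj₂ (residue-quotient-unique (residue a) (quotient a + 1ℤ) (+n-eq a))

  -- The average displacement (1/n) ∑ᵢ (f(i) - i) over i ∈ [n] equals k.
  InComponent : ℕ → AffinePermutation n → Set
  InComponent k f = (∑[ i < n ] (to f [ i ] - [ i ])) ℚ./ n ≡ + k ℚ./ 1

  extend : Permutation′ n → AffinePermutation n
  extend w = record
    { bijection = mk↔ₛ′ (apply (w ⟨$⟩ʳ_)) (apply (w ⟨$⟩ˡ_))
        (apply-inverse (w ⟨$⟩ʳ_) (w ⟨$⟩ˡ_) (λ _ → Perm.inverseʳ w))
        (apply-inverse (w ⟨$⟩ˡ_) (w ⟨$⟩ʳ_) (λ _ → Perm.inverseˡ w))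
    ; periodic  = periodic′
    }
    where
    open ≡-Reasoning
    apply : (Fin n → Fin n) → ℤ → ℤ
    apply g a = [ g (residue a) ] + quotient a * + n

    apply-inverse : ∀ g h → (∀ i → g (h i) ≡ i) → ∀ a → apply g (apply h a) ≡ a
    apply-inverse g h gh a
      with rEq , qEq ← residue-quotient-unique (h (residue a)) (quotient a) refl = begin
      apply g (apply h a)                           ≡⟨ cong₂ (λ r q → [ g r ] + q * + n) rEq qEq ⟩
      [ g (h (residue a)) ] + quotient a * + n      ≡⟨ cong (λ r → [ r ] + quotient a * + n) (gh (residue a)) ⟩
      [ residue a ] + quotient a * + n              ≡⟨ [residue]+quotient a ⟩
      a                                             ∎

    periodic′ : ∀ a → apply (w ⟨$⟩ʳ_) (a + + n) ≡ apply (w ⟨$⟩ʳ_) a + + n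
    periodic′ a = trans
      (cong₂ (λ r q → [ w ⟨$⟩ʳ r ] + q * + n) (residue-+n a) (quotient-+n a))
      (lem [ w ⟨$⟩ʳ residue a ] (quotient a) (+ n))
      where
      lem : ∀ r q m → r + (q + 1ℤ) * m ≡ r + q * m + m
      lem = solve-∀

  -- In s₀,…,sₙ₋₁ the index i : Fin n stands for toℕ i itself, not for [ i ].
  swap : Fin n → ℤ → ℤ
  swap i a with + n ∣? a - + toℕ i | + n ∣? a - (+ toℕ i + 1ℤ)
  ... | yes _ | _     = a + 1ℤ
  ... | no _  | yes _ = a - 1ℤ
  ... | no _  | no _  = a

  swap-lower : ∀ i a → + n ∣ a - + toℕ i → swap i a ≡ a + 1ℤ
  swap-lower i a p with + n ∣? a - + toℕ i | + n ∣? a - (+ toℕ i + 1ℤ)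
  ... | yes _ | _ = refl
  ... | no ¬p | _ = contradiction p ¬p

  swap-upper : ∀ i a → + n ∣ a - (+ toℕ i + 1ℤ) → swap i a ≡ a - 1ℤ
  swap-upper i a q with + n ∣? a - + toℕ i | + n ∣? a - (+ toℕ i + 1ℤ)
  ... | no _  | yes _ = refl
  ... | no _  | no ¬q = contradiction q ¬q
  ... | yes p | _     = contradiction
    (ℕ.∣1⇒≡1 (∣⇒∣ᵤ (subst (+ n ∣_) (lem a (+ toℕ i)) (∣m∣n⇒∣m-n p q))))
    (nonTrivial⇒≢1 {n})
    where
    lem : ∀ a i → (a - i) - (a - (i + 1ℤ)) ≡ 1ℤ
    lem = solve-∀

  swap-other : ∀ i a → ¬ (+ n ∣ a - + toℕ i) → ¬ (+ n ∣ a - (+ toℕ i + 1ℤ)) → swap i a ≡ a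
  swap-other i a ¬p ¬q with + n ∣? a - + toℕ i | + n ∣? a - (+ toℕ i + 1ℤ)
  ... | yes p | _     = contradiction p ¬p
  ... | no _  | yes q = contradiction q ¬q
  ... | no _  | no _  = refl

  s : Fin n → AffinePermutation n
  s i = record
    { bijection = mk↔ₛ′ (swap i) (swap i) involutive involutive
    ; periodic  = periodic′
    }
    where
    involutive : ∀ a → swap i (swap i a) ≡ a
    involutive a with + n ∣? a - + toℕ i | + n ∣? a - (+ toℕ i + 1ℤ)
    ... | yes p | _     = trans (swap-upper i (a + 1ℤ) (subst (+ n ∣_) (lem₁ a (+ toℕ i)) p)) (lem₂ a)
      where
      lem₁ : ∀ a i → a - i ≡ a + 1ℤ - (i + 1ℤ)
      lem₁ = solve-∀
      lem₂ : ∀ a → a + 1ℤ - 1ℤ ≡ a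
      lem₂ = solve-∀
    ... | no _  | yes q = trans (swap-lower i (a - 1ℤ) (subst (+ n ∣_) (lem₁ a (+ toℕ i)) q)) (lem₂ a)
      where
      lem₁ : ∀ a i → a - (i + 1ℤ) ≡ a - 1ℤ - i
      lem₁ = solve-∀
      lem₂ : ∀ a → a - 1ℤ + 1ℤ ≡ a
      lem₂ = solve-∀
    ... | no ¬p | no ¬q = swap-other i a ¬p ¬q

    +n-lem : ∀ a j n → a + n - j ≡ a - j + n
    +n-lem = solve-∀

    up : ∀ a j → + n ∣ a - j → + n ∣ a + + n - j
    up a j p = subst (+ n ∣_) (sym (+n-lem a j (+ n))) (∣m∣n⇒∣m+n p ∣-refl)

    down : ∀ a j → + n ∣ a + + n - j → + n ∣ a - j
    down a j p = ∣m+n∣n⇒∣m (subst (+ n ∣_) (+n-lem a j (+ n)) p) ∣-refl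

    periodic′ : ∀ a → swap i (a + + n) ≡ swap i a + + n
    periodic′ a with + n ∣? a - + toℕ i | + n ∣? a - (+ toℕ i + 1ℤ)
    ... | yes p | _     = trans (swap-lower i (a + + n) (up a _ p)) (lem a (+ n))
      where
      lem : ∀ a n → a + n + 1ℤ ≡ a + 1ℤ + n
      lem = solve-∀
    ... | no _  | yes q = trans (swap-upper i (a + + n) (up a _ q)) (lem a (+ n))
      where
      lem : ∀ a n → a + n - 1ℤ ≡ a - 1ℤ + n
      lem = solve-∀
    ... | no ¬p | no ¬q = swap-other i (a + + n) (¬p ∘ down a _) (¬q ∘ down a _)

  -- The word (s_{i₁},…,s_{iₘ}) is given by its list of indices.
  ⟦_⟧ : List (Fin n) → AffinePermutation n
  ⟦ word ⟧ = foldr _·_ ε (map s word)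

  record IsReducedWord (k : ℕ) (f : AffinePermutation n) (word : List (Fin n)) : Set where
    field
      inComponent : InComponent k f
      factorises  : ⟦ word ⟧ ≈ (Λ ⁻¹) ^ k · f
      reduced     : HasLength f (length word)

  -- a ↦ a + n if the residue of a lies in A, and a ↦ a otherwise.
  translate : {A : Pred (Fin n) 0ℓ} → Decidable A → AffinePermutation n
  translate A? = record
    { bijection = mk↔ₛ′ add subtract add-subtract subtract-add
    ; periodic  = periodic′
    }
    where
    add subtract : ℤ → ℤ
    add      a = if does (A? (residue a)) then a + + n else a
    subtract a = if does (A? (residue a)) then a - + n else a

    add-subtract : ∀ a → add (subtract a) ≡ a
    add-subtract a with does (A? (residue a)) in eq
    ... | true  rewrite residue--n a | eq = lem a (+ n)
      where
      lem : ∀ a n → a - n + n ≡ a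
      lem = solve-∀
    ... | false rewrite eq = refl

    subtract-add : ∀ a → subtract (add a) ≡ a
    subtract-add a with does (A? (residue a)) in eq
    ... | true  rewrite residue-+n a | eq = lem a (+ n)
      where
      lem : ∀ a n → a + n - n ≡ a
      lem = solve-∀
    ... | false rewrite eq = refl

    periodic′ : ∀ a → add (a + + n) ≡ add a + + n
    periodic′ a rewrite residue-+n a with does (A? (residue a))
    ... | true  = refl
    ... | false = refl

τ : ∀ k n .{{_ : NonTrivial n}} → AffinePermutation n
τ k n = translate {n} (λ i → toℕ i ℕ.<? k)

x : ∀ {n} .{{_ : NonTrivial n}} → ℕ → Permutation′ n → AffinePermutation n
x {n} k w = extend w ⁻¹ · τ k n

record IsGrassmannian {n : ℕ} (k : ℕ) (w : Permutation′ n) : Set where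
  field
    increasing-≤k : ∀ {i j} → i Fin.< j → toℕ j ℕ.< k → w ⟨$⟩ʳ i Fin.< w ⟨$⟩ʳ j
    increasing->k : ∀ {i j} → i Fin.< j → k ℕ.≤ toℕ i → w ⟨$⟩ʳ i Fin.< w ⟨$⟩ʳ j

-- w([k]) = {w(1),…,w(k)}
image : ∀ {n} → Permutation′ n → ℕ → Pred (Fin n) 0ℓ
image w k i = ∃ λ j → toℕ j ℕ.< k × w ⟨$⟩ʳ j ≡ i

data Step : Set where
  right up : Step

endpoint : ∀ {m} → Vec Step m → ℕ × ℕ
endpoint []          = 0 , 0
endpoint (right ∷ p) = let x , y = endpoint p in suc x , y
endpoint (up    ∷ p) = let x , y = endpoint p in x , suc y

record LatticePath (k n : ℕ) : Set where
  field
    steps   : Vec Step n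
    reaches : endpoint steps ≡ (n ℕ.∸ k , k)

open LatticePath public

UpSteps : ∀ {k n} → LatticePath k n → Pred (Fin n) 0ℓ
UpSteps P i = lookup (steps P) i ≡ up

upSteps? : ∀ {k n} (P : LatticePath k n) → Decidable (UpSteps P)
upSteps? P i with lookup (steps P) i
... | right = no λ ()
... | up    = yes refl

τ-path : ∀ {k n} .{{_ : NonTrivial n}} → LatticePath k n → AffinePermutation n
τ-path P = translate (upSteps? P)

-- The path with up-steps w([k]) exists.
path-exists : ∀ {k n} → k ℕ.≤ n → (w : Permutation′ n) →
              ∃ λ (P : LatticePath k n) → UpSteps P ≐ image w k
path-exists {k} {n} k≤n w =
  record { steps = tabulate (step ∘ (w ⟨$⟩ˡ_)) ; reaches = cong₂ _,_ rights≡ ups≡ } ,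
  (λ {i} → to-image i) , (λ {i} → from-image i)
  where
  open ≡-Reasoning

  step : ∀ {m} → Fin m → Step
  step i = if does (toℕ i ℕ.<? k) then up else right

  isUp : Step → ℕ
  isUp right = 0
  isUp up    = 1

  ups : ∀ {m} (f : Fin m → Step) → proj₂ (endpoint (tabulate f)) ≡ ℕSum.sum (isUp ∘ f)
  ups {zero}  f = refl
  ups {suc m} f with f Fin.zero
  ... | right = ups (f ∘ Fin.suc)
  ... | up    = cong suc (ups (f ∘ Fin.suc))

  total : ∀ {m} (p : Vec Step m) → proj₁ (endpoint p) ℕ.+ proj₂ (endpoint p) ≡ m
  total []          = refl
  total (right ∷ p) = cong suc (total p)
  total (up    ∷ p) = trans (ℕ.+-suc _ _) (cong suc (total p))

  count : ∀ m l → l ℕ.≤ m →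
          ℕSum.sum {m} (λ i → isUp (if does (toℕ i ℕ.<? l) then up else right)) ≡ l
  count zero    zero    _         = refl
  count (suc m) zero    _         = count m zero ℕ.z≤n
  count (suc m) (suc l) (ℕ.s≤s p) = cong suc (count m l p)

  ups≡ : proj₂ (endpoint (tabulate (step ∘ (w ⟨$⟩ˡ_)))) ≡ k
  ups≡ = begin
    proj₂ (endpoint (tabulate (step ∘ (w ⟨$⟩ˡ_)))) ≡⟨ ups (step ∘ (w ⟨$⟩ˡ_)) ⟩
    ℕSum.sum (isUp ∘ step ∘ (w ⟨$⟩ˡ_))             ≡⟨ ℕSum.sum-permute (isUp ∘ step) (Perm.flip w) ⟨
    ℕSum.sum (isUp ∘ step {n})                     ≡⟨ count n k k≤n ⟩
    k                                              ∎

  rights≡ : proj₁ (endpoint (tabulate (step ∘ (w ⟨$⟩ˡ_)))) ≡ n ℕ.∸ k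
  rights≡ = begin
    r                ≡⟨ ℕ.m+n∸n≡m r k ⟨
    r ℕ.+ k ℕ.∸ k    ≡⟨ cong (λ u → r ℕ.+ u ℕ.∸ k) ups≡ ⟨
    r ℕ.+ u ℕ.∸ k    ≡⟨ cong (ℕ._∸ k) (total p) ⟩
    n ℕ.∸ k          ∎
    where
    p = tabulate (step ∘ (w ⟨$⟩ˡ_))
    r = proj₁ (endpoint p)
    u = proj₂ (endpoint p)

  to-image : ∀ i → lookup (tabulate (step ∘ (w ⟨$⟩ˡ_))) i ≡ up → image w k i
  to-image i eq with toℕ (w ⟨$⟩ˡ i) ℕ.<? k
  ... | yes lt = w ⟨$⟩ˡ i , lt , Perm.inverseʳ w
  ... | no ¬lt = contradiction (begin
    right                                   ≡⟨ cong (if_then up else right) (dec-false (toℕ (w ⟨$⟩ˡ i) ℕ.<? k) ¬lt) ⟨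
    step (w ⟨$⟩ˡ i)                         ≡⟨ lookup∘tabulate (step ∘ (w ⟨$⟩ˡ_)) i ⟨
    lookup (tabulate (step ∘ (w ⟨$⟩ˡ_))) i  ≡⟨ eq ⟩
    up                                      ∎) λ ()

  from-image : ∀ i → image w k i → lookup (tabulate (step ∘ (w ⟨$⟩ˡ_))) i ≡ up
  from-image .(w ⟨$⟩ʳ j) (j , lt , refl) = begin
    lookup (tabulate (step ∘ (w ⟨$⟩ˡ_))) (w ⟨$⟩ʳ j) ≡⟨ lookup∘tabulate (step ∘ (w ⟨$⟩ˡ_)) (w ⟨$⟩ʳ j) ⟩
    step (w ⟨$⟩ˡ (w ⟨$⟩ʳ j))                        ≡⟨ cong step (Perm.inverseˡ w) ⟩
    step j                                          ≡⟨ cong (if_then up else right) (dec-true (toℕ j ℕ.<? k) lt) ⟩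
    up                                              ∎

{-# OPTIONS --safe #-}

-- Write an integer as (r , q) with r ∈ [n] its residue and q its quotient, so
-- that the order on ℤ is lexicographic with q first.  Since w, x_w and τ_P only
-- permute residues and shift quotients by 0 or 1, comparing coordinates shows
-- that each of their inversions comes from a pair (j , l) with j ≤ k < l:
-- for w from the pairs with w(j) > w(l), for x_w from those with w(j) < w(l),
-- and for τ_P from every pair, exactly once.  Hence ℓ(x_w) + ℓ(w) and ℓ(τ_P)
-- are both k(n − k).

module Submission where

open import Defs
import Algebra.Properties.CommutativeMonoid.Sum as Sum
open import Data.Bool.Base using (if_then_else_)
open import Data.Fin.Base as Fin using (Fin; toℕ; fromℕ<; _↑ˡ_; _↑ʳ_; splitAt)
open import Data.Fin.Permutation as Perm using (Permutation′; _⟨$⟩ʳ_; _⟨$⟩ˡ_)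
import Data.Fin.Properties as Fin
open import Data.Integer.Base as ℤ using (ℤ; +_; 0ℤ; 1ℤ)
import Data.Integer.Properties as ℤ
open import Data.Integer.Tactic.RingSolver using (solve-∀)
open import Data.List.Base using (List; []; _∷_; length; _++_)
open import Data.List.Properties using (length-++)
open import Data.Nat.Base as ℕ using (ℕ; zero; suc; _≤_; _∸_; _*_; NonTrivial; NonZero; nonTrivial⇒nonZero)
import Data.Nat.Properties as ℕ
open import Data.Product.Base using (_×_; _,_; proj₁; proj₂; Σ; ∃; ∃₂; uncurry)
import Data.Rational.Base as ℚ
import Data.Rational.Properties as ℚ
import Data.Rational.Unnormalised.Base as ℚᵘ
open import Data.Sum.Base using (_⊎_; inj₁; inj₂; [_,_]′)
open import Data.Sum.Function.Propositional using (_⊎-↔_)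
open import Data.Unit.Base using (⊤; tt)
open import Function.Base using (_∘_)
open import Function.Bundles using (_↔_; mk↔ₛ′; mk⤖)
open import Function.Consequences.Propositional using (strictlySurjective⇒surjective)
open import Function.Construct.Composition using (_↔-∘_)
open import Function.Construct.Symmetry using (↔-sym)
open import Function.Properties.Bijection using (⤖⇒↔)
open import Level using (0ℓ)
open import Relation.Binary.Definitions using (tri<; tri≈; tri>)
open import Relation.Binary.PropositionalEquality using (_≡_; _≢_; refl; sym; trans; cong; cong₂; subst; subst₂; module ≡-Reasoning)
open import Relation.Nullary using (¬_; Irrelevant; does; contradiction)
open import Relation.Nullary.Decidable using (dec-true; dec-false)
open import Relation.Unary using (Pred; Decidable; _≐_)

open AffinePermutation using (to; from)
module ℤSum = Sum ℤ.+-0-commutativeMonoid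

-- Coordinates of integers

-- Opaque so that r and q can be inferred from the integer at r q.
opaque
  at : ∀ {n} → Fin n → ℤ → ℤ
  at {n} r q = [ r ] ℤ.+ q ℤ.* + n

  []≡at-0 : ∀ {n} (r : Fin n) → [ r ] ≡ at r 0ℤ
  []≡at-0 r = sym (ℤ.+-identityʳ [ r ])

  at-suc : ∀ {n} (r : Fin n) q → at r (q ℤ.+ 1ℤ) ≡ at r q ℤ.+ + n
  at-suc {n} r q = lem [ r ] q (+ n)
    where
    lem : ∀ r q n → r ℤ.+ (q ℤ.+ 1ℤ) ℤ.* n ≡ r ℤ.+ q ℤ.* n ℤ.+ n
    lem = solve-∀

  at-mono-<ˡ : ∀ {n} {r r′ : Fin n} q → r Fin.< r′ → at r q ℤ.< at r′ q
  at-mono-<ˡ {n} q r<r′ = ℤ.+-monoˡ-< (q ℤ.* + n) (ℤ.+<+ (ℕ.s≤s r<r′))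

  -- Residues run from 1 to n, so the block of quotient `q` ends at `(q + 1) * n` and every later
  -- block starts strictly above it.
  at-mono-<ʳ : ∀ {n} (r r′ : Fin n) {q q′} → q ℤ.< q′ → at r q ℤ.< at r′ q′
  at-mono-<ʳ {n} r r′ {q} {q′} q<q′ = begin-strict
    [ r ] ℤ.+ q ℤ.* + n    ≤⟨ ℤ.+-monoˡ-≤ (q ℤ.* + n) (ℤ.+≤+ (Fin.toℕ<n r)) ⟩
    + n ℤ.+ q ℤ.* + n      ≡⟨ ℤ.suc-* q (+ n) ⟨
    (1ℤ ℤ.+ q) ℤ.* + n     ≤⟨ ℤ.*-monoʳ-≤-nonNeg (+ n) (ℤ.i<j⇒suc[i]≤j q<q′) ⟩
    q′ ℤ.* + n             ≡⟨ ℤ.+-identityˡ _ ⟨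
    0ℤ ℤ.+ q′ ℤ.* + n      <⟨ ℤ.+-monoˡ-< (q′ ℤ.* + n) (ℤ.+<+ ℕ.z<s) ⟩
    [ r′ ] ℤ.+ q′ ℤ.* + n  ∎
    where open ℤ.≤-Reasoning

at-cancel-< : ∀ {n} {r r′ : Fin n} {q q′} → at r q ℤ.< at r′ q′ →
              q ℤ.< q′ ⊎ (q ≡ q′ × r Fin.< r′)
at-cancel-< {r = r} {r′} {q} {q′} lt with ℤ.<-cmp q q′
... | tri< q<q′ _ _ = inj₁ q<q′
... | tri> _ _ q′<q = contradiction (at-mono-<ʳ r′ r q′<q) (ℤ.<-asym lt)
... | tri≈ _ refl _ with Fin.<-cmp r r′
...   | tri< r<r′ _ _ = inj₂ (refl , r<r′)
...   | tri≈ _ refl _ = contradiction lt (ℤ.<-irrefl refl)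
...   | tri> _ _ r′<r = contradiction (at-mono-<ˡ q r′<r) (ℤ.<-asym lt)

at-suc-cancel-< : ∀ {n} {r r′ : Fin n} {q q′} →
                  at r (q ℤ.+ 1ℤ) ℤ.< at r′ (q′ ℤ.+ 1ℤ) → at r q ℤ.< at r′ q′
at-suc-cancel-< {n} {r} {r′} {q} {q′} lt = ℤ.≰⇒> λ le → ℤ.<⇒≱ lt (subst₂ ℤ._≤_
  (sym (at-suc r′ q′)) (sym (at-suc r q)) (ℤ.+-monoˡ-≤ (+ n) le))

-- Neither quotient changes, so different quotients would fix the order before and after alike; only
-- residues can cause a reversal.
at-inverted : ∀ {n} {p r p′ r′ : Fin n} {q q′} →
              at p q ℤ.< at r q′ → at r′ q′ ℤ.< at p′ q →
              q ≡ q′ × p Fin.< r × r′ Fin.< p′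
at-inverted lt gt with at-cancel-< lt | at-cancel-< gt
... | inj₁ q<q′         | inj₁ q′<q         = contradiction q′<q (ℤ.<-asym q<q′)
... | inj₁ q<q′         | inj₂ (refl , _)   = contradiction q<q′ (ℤ.<-irrefl refl)
... | inj₂ (refl , _)   | inj₁ q′<q         = contradiction q′<q (ℤ.<-irrefl refl)
... | inj₂ (q≡q′ , p<r) | inj₂ (_ , r′<p′)  = q≡q′ , p<r , r′<p′

-- The lower point rises from quotient 0 to 1 while the other stays at `q`. Thus `lt` gives 0 ≤ `q`,
-- `gt` gives `q` ≤ 1, and at either end a tie of quotients is broken by residues.
at-inverted-suc : ∀ {n} {p r p′ r′ : Fin n} {q} →
                  at p 0ℤ ℤ.< at r q → at r′ q ℤ.< at p′ 1ℤ →
                  (q ≡ 0ℤ × p Fin.< r) ⊎ (q ≡ 1ℤ × r′ Fin.< p′)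
at-inverted-suc lt gt with at-cancel-< lt | at-cancel-< gt
... | inj₁ (ℤ.+<+ (ℕ.s≤s _)) | inj₁ (ℤ.+<+ (ℕ.s≤s ()))
... | _                      | inj₂ (refl , r′<p′) = inj₂ (refl , r′<p′)
... | inj₂ (refl , p<r)      | inj₁ _              = inj₁ (refl , p<r)

-- Raising the larger point cannot bring it below the other: `lt` forces `q` ≥ 0, whereas `gt` would
-- need `q` + 1 ≤ 0.
at-not-inverted-pred : ∀ {n} {p r p′ r′ : Fin n} {q} →
                       at p 0ℤ ℤ.< at r q → ¬ at r′ (q ℤ.+ 1ℤ) ℤ.< at p′ 0ℤ
at-not-inverted-pred {q = + _} lt gt with at-cancel-< gt
... | inj₁ (ℤ.+<+ ())
... | inj₂ (eq , _) = ℕ.m+1+n≢0 _ (ℤ.+-injective eq)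
at-not-inverted-pred {q = ℤ.-[1+ _ ]} lt gt with at-cancel-< lt
... | inj₁ ()
... | inj₂ (() , _)

-- The window [n] in `Inversion` is the block of quotient 0, so the first entry of an inversion is
-- given by its residue alone.
at-0-surjective : ∀ {n a} → 1ℤ ℤ.≤ a → a ℤ.≤ + n → ∃ λ (r : Fin n) → at r 0ℤ ≡ a
at-0-surjective {a = + suc i} _ (ℤ.+≤+ i<n) =
  fromℕ< i<n , trans (sym ([]≡at-0 _)) (cong (+_ ∘ suc) (Fin.toℕ-fromℕ< i<n))
at-0-surjective {a = + zero} (ℤ.+≤+ ())

1≤at-0 : ∀ {n} (r : Fin n) → 1ℤ ℤ.≤ at r 0ℤ
1≤at-0 r = subst (1ℤ ℤ.≤_) ([]≡at-0 r) (ℤ.+≤+ (ℕ.s≤s ℕ.z≤n))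

at-0≤n : ∀ {n} (r : Fin n) → at r 0ℤ ℤ.≤ + n
at-0≤n {n} r = subst (ℤ._≤ + n) ([]≡at-0 r) (ℤ.+≤+ (Fin.toℕ<n r))

-- Affine permutations in coordinates

module _ {n : ℕ} .{{_ : NonTrivial n}} where

  opaque
    unfolding at

    residue-at : ∀ (r : Fin n) q → residue (at r q) ≡ r
    residue-at r q = proj₁ (residue-quotient-unique r q refl)

    at-residue-quotient : ∀ a → at {n} (residue a) (quotient a) ≡ a
    at-residue-quotient = [residue]+quotient

    extend-at : ∀ (w : Permutation′ n) r q → to (extend w) (at r q) ≡ at (w ⟨$⟩ʳ r) q
    extend-at w r q with rEq , qEq ← residue-quotient-unique r q refl =
      cong₂ (λ r q → at (w ⟨$⟩ʳ r) q) rEq qEq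

  at-injectiveˡ : ∀ {r r′ : Fin n} {q q′} → at r q ≡ at r′ q′ → r ≡ r′
  at-injectiveˡ {r} {r′} {q} {q′} eq =
    trans (sym (residue-at r q)) (trans (cong residue eq) (residue-at r′ q′))

  extend⁻¹-at : ∀ (w : Permutation′ n) r q → from (extend w) (at (w ⟨$⟩ʳ r) q) ≡ at r q
  extend⁻¹-at w r q = trans (cong (from (extend w)) (sym (extend-at w r q)))
    (AffinePermutation.from∘to (extend w) (at r q))

  module _ {A : Pred (Fin n) 0ℓ} (A? : Decidable A) where

    translate-∈ : ∀ {r} q → A r → to (translate A?) (at r q) ≡ at r (q ℤ.+ 1ℤ)
    translate-∈ {r} q r∈A
      rewrite residue-at r q | dec-true (A? r) r∈A = sym (at-suc r q)

    translate-∉ : ∀ {r} q → ¬ A r → to (translate A?) (at r q) ≡ at r q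
    translate-∉ {r} q r∉A rewrite residue-at r q | dec-false (A? r) r∉A = refl

  Inversion-≡ : ∀ (f : AffinePermutation n) {i j : Inversion f} →
                proj₁ i ≡ proj₁ j → proj₁ (proj₂ i) ≡ proj₁ (proj₂ j) → i ≡ j
  Inversion-≡ f {a , b , (l₁ , u₁) , lt₁ , gt₁} {_ , _ , (l₂ , u₂) , lt₂ , gt₂} refl refl
    rewrite ℤ.≤-irrelevant l₁ l₂ | ℤ.≤-irrelevant u₁ u₂
          | ℤ.<-irrelevant lt₁ lt₂ | ℤ.<-irrelevant gt₁ gt₂ = refl

  ⟦⟧-++ : ∀ (u v : List (Fin n)) → ⟦ u ++ v ⟧ ≈ ⟦ u ⟧ · ⟦ v ⟧
  ⟦⟧-++ []      v i = refl
  ⟦⟧-++ (a ∷ u) v i = ⟦⟧-++ u v (swap a i)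

-- Inversions indexed by pairs j ≤ k < l

perm-injective : ∀ {n} (π : Permutation′ n) {i j} → π ⟨$⟩ʳ i ≡ π ⟨$⟩ʳ j → i ≡ j
perm-injective π eq =
  trans (sym (Perm.inverseˡ π)) (trans (cong (π ⟨$⟩ˡ_) eq) (Perm.inverseˡ π))

module _ {k m : ℕ} where

  -- A view of indices: matching on it replaces the index in the goal by `j ↑ˡ m` or `k ↑ʳ l`.
  data Side : Fin (k ℕ.+ m) → Set where
    low  : ∀ j → Side (j ↑ˡ m)
    high : ∀ l → Side (k ↑ʳ l)

  side : ∀ i → Side i
  side i with splitAt k i in eq
  ... | inj₁ j = subst Side (Fin.splitAt⁻¹-↑ˡ eq) (low j)
  ... | inj₂ l = subst Side (Fin.splitAt⁻¹-↑ʳ eq) (high l)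

  low<k : ∀ (j : Fin k) → toℕ (j ↑ˡ m) ℕ.< k
  low<k j = subst (ℕ._< k) (sym (Fin.toℕ-↑ˡ j m)) (Fin.toℕ<n j)

  k≤high : ∀ (l : Fin m) → k ≤ toℕ (k ↑ʳ l)
  k≤high l = subst (k ≤_) (sym (Fin.toℕ-↑ʳ k l)) (ℕ.m≤m+n k (toℕ l))

  low<high : ∀ (j : Fin k) (l : Fin m) → j ↑ˡ m Fin.< k ↑ʳ l
  low<high j l = ℕ.<-≤-trans (low<k j) (k≤high l)

  ∑-low : ∀ c (g : Fin (k ℕ.+ m) → ℤ) → (∀ j → g (j ↑ˡ m) ≡ c) → (∀ l → g (k ↑ʳ l) ≡ 0ℤ) →
          ℤSum.sum g ≡ + k ℤ.* c
  ∑-low c = go k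
    where
    -- The recursion varies its own `k` with `c` fixed, as `c` will be `+ (k ℕ.+ m)` for the outer
    -- `k`.
    go : ∀ k (g : Fin (k ℕ.+ m) → ℤ) → (∀ j → g (j ↑ˡ m) ≡ c) → (∀ l → g (k ↑ʳ l) ≡ 0ℤ) →
         ℤSum.sum g ≡ + k ℤ.* c
    go zero    g gl gh = trans (ℤSum.sum-cong-≗ gh) (ℤSum.sum-replicate-zero m)
    go (suc k) g gl gh = trans
      (cong₂ ℤ._+_ (gl Fin.zero) (go k (g ∘ Fin.suc) (gl ∘ Fin.suc) gh))
      (sym (ℤ.suc-* (+ k) c))

  module _ .{{_ : NonTrivial (k ℕ.+ m)}} where

    -- As the first entry has quotient 0, an inversion amounts to two residues and one quotient.
    -- With residues labelled through `π`, the pair `(j , l)` gives the former and `c j l` the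
    -- latter; `Q` selects the pairs that occur. This one count serves w, x_w and τ_P.
    inversions↔ : (f : AffinePermutation (k ℕ.+ m)) (π : Permutation′ (k ℕ.+ m))
      (c : Fin k → Fin m → ℤ) {Q : Fin k → Fin m → Set} →
      (∀ {j l} → Irrelevant (Q j l)) →
      (∀ j l → Q j l → at (π ⟨$⟩ʳ (j ↑ˡ m)) 0ℤ ℤ.< at (π ⟨$⟩ʳ (k ↑ʳ l)) (c j l)
                     × to f (at (π ⟨$⟩ʳ (k ↑ʳ l)) (c j l)) ℤ.< to f (at (π ⟨$⟩ʳ (j ↑ˡ m)) 0ℤ)) →
      (∀ p r q → at (π ⟨$⟩ʳ p) 0ℤ ℤ.< at (π ⟨$⟩ʳ r) q →
                 to f (at (π ⟨$⟩ʳ r) q) ℤ.< to f (at (π ⟨$⟩ʳ p) 0ℤ) →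
                 ∃₂ λ j l → Q j l × j ↑ˡ m ≡ p × k ↑ʳ l ≡ r × c j l ≡ q) →
      Σ (Fin k × Fin m) (uncurry Q) ↔ Inversion f
    inversions↔ f π c {Q} Q-irr sound complete =
      ⤖⇒↔ (mk⤖ (injective , strictlySurjective⇒surjective surjective))
      where
      inversion : Σ (Fin k × Fin m) (uncurry Q) → Inversion f
      inversion ((j , l) , jlQ) = _ , _ , (1≤at-0 _ , at-0≤n _) , sound j l jlQ

      injective : ∀ {u v} → inversion u ≡ inversion v → u ≡ v
      injective {(j , l) , jlQ} {(j′ , l′) , jlQ′} eq
        with refl ← Fin.↑ˡ-injective m j j′ (perm-injective π (at-injectiveˡ (cong proj₁ eq)))
        with refl ← Fin.↑ʳ-injective k l l′ (perm-injective π (at-injectiveˡ (cong (proj₁ ∘ proj₂) eq)))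
        = cong ((j , l) ,_) (Q-irr jlQ jlQ′)

      coordinates : ∀ b → ∃₂ λ r q → at (π ⟨$⟩ʳ r) q ≡ b
      coordinates b = π ⟨$⟩ˡ residue b , quotient b ,
        trans (cong (λ r → at r (quotient b)) (Perm.inverseʳ π)) (at-residue-quotient b)

      coordinate-0 : ∀ {a} → 1ℤ ℤ.≤ a → a ℤ.≤ + (k ℕ.+ m) → ∃ λ p → at (π ⟨$⟩ʳ p) 0ℤ ≡ a
      coordinate-0 1≤a a≤n with r , eq ← at-0-surjective 1≤a a≤n =
        π ⟨$⟩ˡ r , trans (cong (λ r → at r 0ℤ) (Perm.inverseʳ π)) eq

      surjective : ∀ i → ∃ λ u → inversion u ≡ i
      surjective (a , b , (1≤a , a≤n) , a<b , fa>fb)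
        with p , refl ← coordinate-0 1≤a a≤n
        with r , q , refl ← coordinates b
        with j , l , jlQ , refl , refl , refl ← complete p r q a<b fa>fb
        = ((j , l) , jlQ) , Inversion-≡ f refl refl

    -- The common shape of x_w and τ_P: `π` labels residues before `f` and `φ` after it. `π` is w in
    -- both cases; `φ` is the identity for x_w and w for τ_P.
    module ShiftLow (f : AffinePermutation (k ℕ.+ m)) (π φ : Permutation′ (k ℕ.+ m))
      (f-low  : ∀ j q → to f (at (π ⟨$⟩ʳ (j ↑ˡ m)) q) ≡ at (φ ⟨$⟩ʳ (j ↑ˡ m)) (q ℤ.+ 1ℤ))
      (f-high : ∀ l q → to f (at (π ⟨$⟩ʳ (k ↑ʳ l)) q) ≡ at (φ ⟨$⟩ʳ (k ↑ʳ l)) q)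
      (low-mono  : ∀ j j′ → π ⟨$⟩ʳ (j ↑ˡ m) Fin.< π ⟨$⟩ʳ (j′ ↑ˡ m) →
                   ¬ φ ⟨$⟩ʳ (j′ ↑ˡ m) Fin.< φ ⟨$⟩ʳ (j ↑ˡ m))
      (high-mono : ∀ l l′ → π ⟨$⟩ʳ (k ↑ʳ l) Fin.< π ⟨$⟩ʳ (k ↑ʳ l′) →
                   ¬ φ ⟨$⟩ʳ (k ↑ʳ l′) Fin.< φ ⟨$⟩ʳ (k ↑ʳ l))
      where

      -- Two points on the same side shift equally, so a reversal would be one of residues, against
      -- monotonicity. A low point above a high one only moves further up. What remains is a low
      -- point passing a high one.
      classify : ∀ p r q → at (π ⟨$⟩ʳ p) 0ℤ ℤ.< at (π ⟨$⟩ʳ r) q →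
                 to f (at (π ⟨$⟩ʳ r) q) ℤ.< to f (at (π ⟨$⟩ʳ p) 0ℤ) →
                 ∃₂ λ j l → j ↑ˡ m ≡ p × k ↑ʳ l ≡ r ×
                   ((q ≡ 0ℤ × π ⟨$⟩ʳ p Fin.< π ⟨$⟩ʳ r) ⊎ (q ≡ 1ℤ × φ ⟨$⟩ʳ r Fin.< φ ⟨$⟩ʳ p))
      classify p r q lt gt with side p | side r
      ... | low j  | low j′
        with _ , p<r , r<p ← at-inverted lt (at-suc-cancel-< (subst₂ ℤ._<_ (f-low j′ q) (f-low j 0ℤ) gt))
        = contradiction r<p (low-mono j j′ p<r)
      ... | high l | high l′
        with _ , p<r , r<p ← at-inverted lt (subst₂ ℤ._<_ (f-high l′ q) (f-high l 0ℤ) gt)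
        = contradiction r<p (high-mono l l′ p<r)
      ... | high l | low j  =
        contradiction (subst₂ ℤ._<_ (f-low j q) (f-high l 0ℤ) gt) (at-not-inverted-pred lt)
      ... | low j  | high l = j , l , refl , refl ,
        at-inverted-suc lt (subst₂ ℤ._<_ (f-high l q) (f-low j 0ℤ) gt)

      -- The low point reaches quotient 1 and the high one stays at 0, so residues do not matter.
      f-inverts-0 : ∀ j l → to f (at (π ⟨$⟩ʳ (k ↑ʳ l)) 0ℤ) ℤ.< to f (at (π ⟨$⟩ʳ (j ↑ˡ m)) 0ℤ)
      f-inverts-0 j l = subst₂ ℤ._<_ (sym (f-high l 0ℤ)) (sym (f-low j 0ℤ))
        (at-mono-<ʳ _ _ (ℤ.+<+ ℕ.z<s))

      -- Both images have quotient 1, so their residues under `φ` decide.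
      f-inverts-1 : ∀ j l → φ ⟨$⟩ʳ (k ↑ʳ l) Fin.< φ ⟨$⟩ʳ (j ↑ˡ m) →
                    to f (at (π ⟨$⟩ʳ (k ↑ʳ l)) 1ℤ) ℤ.< to f (at (π ⟨$⟩ʳ (j ↑ˡ m)) 0ℤ)
      f-inverts-1 j l r<p = subst₂ ℤ._<_ (sym (f-high l 1ℤ)) (sym (f-low j 0ℤ))
        (at-mono-<ˡ 1ℤ r<p)

-- Lengths of w, x_w and τ_P

-- For unnormalised fractions equality is cross multiplication, which here is `eq`; normalisation
-- respects it.
i/n≡k/1 : ∀ i k n .{{_ : NonZero n}} → i ≡ + k ℤ.* + n → i ℚ./ n ≡ + k ℚ./ 1
i/n≡k/1 i k (suc n) eq = ℚ.fromℚᵘ-cong {ℚᵘ.mkℚᵘ i n} {ℚᵘ.mkℚᵘ (+ k) 0}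
  (ℚᵘ.*≡* (trans (ℤ.*-identityʳ i) eq))

Σ-⊎-↔ : ∀ {A : Set} {P Q : A → Set} → (∀ {a} → Irrelevant (P a)) → (∀ {a} → Irrelevant (Q a)) →
        (∀ {a} → P a → ¬ Q a) → (∀ a → P a ⊎ Q a) → (Σ A P ⊎ Σ A Q) ↔ A
Σ-⊎-↔ {A} {P} {Q} P-irr Q-irr disjoint cover = mk↔ₛ′ forget choose forget-choose choose-forget
  where
  forget : Σ A P ⊎ Σ A Q → A
  forget = [ proj₁ , proj₁ ]′
  choose : A → Σ A P ⊎ Σ A Q
  choose a with cover a
  ... | inj₁ p = inj₁ (a , p)
  ... | inj₂ q = inj₂ (a , q)
  forget-choose : ∀ a → forget (choose a) ≡ a
  forget-choose a with cover a
  ... | inj₁ _ = refl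
  ... | inj₂ _ = refl
  choose-forget : ∀ s → choose (forget s) ≡ s
  choose-forget (inj₁ (a , p)) with cover a
  -- `cover` may return another proof than the one forgotten; irrelevance identifies the two.
  ... | inj₁ p′ = cong (inj₁ ∘ (a ,_)) (P-irr p′ p)
  ... | inj₂ q  = contradiction q (disjoint p)
  choose-forget (inj₂ (a , q)) with cover a
  ... | inj₁ p  = contradiction q (disjoint p)
  ... | inj₂ q′ = cong (inj₂ ∘ (a ,_)) (Q-irr q′ q)

module _ {k m : ℕ} .{{_ : NonTrivial (k ℕ.+ m)}} (w : Permutation′ (k ℕ.+ m)) where

  private
    instance
      nonZero : NonZero (k ℕ.+ m)
      nonZero = nonTrivial⇒nonZero (k ℕ.+ m)

    wˡ : Fin k → Fin (k ℕ.+ m)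
    wˡ j = w ⟨$⟩ʳ (j ↑ˡ m)

    wʳ : Fin m → Fin (k ℕ.+ m)
    wʳ l = w ⟨$⟩ʳ (k ↑ʳ l)

    wˡ≢wʳ : ∀ j l → wˡ j ≢ wʳ l
    wˡ≢wʳ j l eq = ℕ.<-irrefl (cong toℕ (perm-injective w eq)) (low<high j l)

  -- Products are read left to right: the inverse of w first turns `wˡ j` into `j ↑ˡ m`, a residue
  -- that `τ` shifts.
  x-at-low : ∀ j q → to (x k w) (at (wˡ j) q) ≡ at (j ↑ˡ m) (q ℤ.+ 1ℤ)
  x-at-low j q = trans (cong (to (τ k (k ℕ.+ m))) (extend⁻¹-at w (j ↑ˡ m) q))
    (translate-∈ (λ i → toℕ i ℕ.<? k) q (low<k j))

  x-at-high : ∀ l q → to (x k w) (at (wʳ l) q) ≡ at (k ↑ʳ l) q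
  x-at-high l q = trans (cong (to (τ k (k ℕ.+ m))) (extend⁻¹-at w (k ↑ʳ l) q))
    (translate-∉ (λ i → toℕ i ℕ.<? k) q (ℕ.≤⇒≯ (k≤high l)))

  module _ (grassmannian : IsGrassmannian k w) where
    open IsGrassmannian grassmannian

    increasing-low : ∀ {j j′} → j ↑ˡ m Fin.< j′ ↑ˡ m → wˡ j Fin.< wˡ j′
    increasing-low {j′ = j′} lt = increasing-≤k lt (low<k j′)

    increasing-high : ∀ {l l′} → k ↑ʳ l Fin.< k ↑ʳ l′ → wʳ l Fin.< wʳ l′
    increasing-high {l} lt = increasing->k lt (k≤high l)

    -- w preserves quotients, so both entries have quotient 0. The Grassmannian condition excludes
    -- pairs on one side, and low indices precede high ones.
    inversions-w : Σ (Fin k × Fin m) (λ (j , l) → wʳ l Fin.< wˡ j) ↔ Inversion (extend w)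
    inversions-w = inversions↔ (extend w) Perm.id (λ _ _ → 0ℤ) ℕ.<-irrelevant sound complete
      where
      sound : ∀ j l → wʳ l Fin.< wˡ j → at (j ↑ˡ m) 0ℤ ℤ.< at (k ↑ʳ l) 0ℤ
              × to (extend w) (at (k ↑ʳ l) 0ℤ) ℤ.< to (extend w) (at (j ↑ˡ m) 0ℤ)
      sound j l lt = at-mono-<ˡ 0ℤ (low<high j l) ,
        subst₂ ℤ._<_ (sym (extend-at w _ 0ℤ)) (sym (extend-at w _ 0ℤ)) (at-mono-<ˡ 0ℤ lt)

      complete : ∀ p r q → at p 0ℤ ℤ.< at r q →
                 to (extend w) (at r q) ℤ.< to (extend w) (at p 0ℤ) →
                 ∃₂ λ j l → wʳ l Fin.< wˡ j × j ↑ˡ m ≡ p × k ↑ʳ l ≡ r × 0ℤ ≡ q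
      complete p r q lt gt
        with 0≡q , p<r , wr<wp ← at-inverted lt (subst₂ ℤ._<_ (extend-at w r q) (extend-at w p 0ℤ) gt)
        with side {k} {m} p | side {k} {m} r
      ... | low j  | high l  = j , l , wr<wp , refl , refl , 0≡q
      ... | low j  | low j′  = contradiction wr<wp (ℕ.<-asym (increasing-low {j} {j′} p<r))
      ... | high l | high l′ = contradiction wr<wp (ℕ.<-asym (increasing-high {l} {l′} p<r))
      ... | high l | low j   = contradiction p<r (ℕ.<-asym (low<high j l))

    inversions-x : Σ (Fin k × Fin m) (λ (j , l) → wˡ j Fin.< wʳ l) ↔ Inversion (x k w)
    inversions-x = inversions↔ (x k w) w (λ _ _ → 0ℤ) ℕ.<-irrelevant
      (λ j l lt → at-mono-<ˡ 0ℤ lt , f-inverts-0 j l) complete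
      where
      -- With `φ` the identity, a reversal would be one of the indices themselves, and w is
      -- increasing on each side.
      open ShiftLow (x k w) w Perm.id x-at-low x-at-high
        (λ j j′ lt gt → ℕ.<-asym lt (increasing-low gt))
        (λ l l′ lt gt → ℕ.<-asym lt (increasing-high gt))

      complete : ∀ p r q → at (w ⟨$⟩ʳ p) 0ℤ ℤ.< at (w ⟨$⟩ʳ r) q →
                 to (x k w) (at (w ⟨$⟩ʳ r) q) ℤ.< to (x k w) (at (w ⟨$⟩ʳ p) 0ℤ) →
                 ∃₂ λ j l → wˡ j Fin.< wʳ l × j ↑ˡ m ≡ p × k ↑ʳ l ≡ r × 0ℤ ≡ q
      complete p r q lt gt with classify p r q lt gt
      ... | j , l , refl , refl , inj₁ (q≡0 , p<r) = j , l , p<r , refl , refl , sym q≡0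
      -- Quotient 1 would need a high index below a low one, since `φ` is the identity.
      ... | j , l , refl , refl , inj₂ (_ , r<p)   = contradiction r<p (ℕ.<-asym (low<high j l))

    -- `wˡ j` and `wʳ l` are distinct, so each pair `(j , l)` is counted once: by x_w in one order,
    -- by w in the other.
    lengths-sum : ∀ {a b} → HasLength (x k w) a → HasLength (extend w) b → a ℕ.+ b ≡ k * m
    lengths-sum {a} {b} lx lw = Perm.↔⇒≡
      (↔-sym Fin.*↔× ↔-∘ (pairs ↔-∘ (inversions ↔-∘ Fin.+↔⊎ {a} {b})))
      where
      cover : ∀ ((j , l) : Fin k × Fin m) → wˡ j Fin.< wʳ l ⊎ wʳ l Fin.< wˡ j
      cover (j , l) with Fin.<-cmp (wˡ j) (wʳ l)
      ... | tri< lt _ _ = inj₁ lt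
      ... | tri≈ _ eq _ = contradiction eq (wˡ≢wʳ j l)
      ... | tri> _ _ gt = inj₂ gt
      inversions = (↔-sym inversions-x ↔-∘ ↔-sym lx) ⊎-↔ (↔-sym inversions-w ↔-∘ ↔-sym lw)
      pairs = Σ-⊎-↔ ℕ.<-irrelevant ℕ.<-irrelevant ℕ.<-asym cover

  module _ {A : Pred (Fin (k ℕ.+ m)) 0ℓ} (A? : Decidable A) (A≐image : A ≐ image w k) where

    private
      f = translate A?

      low∈A : ∀ j → A (wˡ j)
      low∈A j = proj₂ A≐image (j ↑ˡ m , low<k j , refl)

      high∉A : ∀ l → ¬ A (wʳ l)
      high∉A l wl∈A with i , i<k , wi≡wl ← proj₁ A≐image wl∈A
        with refl ← perm-injective w wi≡wl = ℕ.<⇒≱ i<k (k≤high l)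

    f-low : ∀ j q → to f (at (wˡ j) q) ≡ at (wˡ j) (q ℤ.+ 1ℤ)
    f-low j q = translate-∈ A? q (low∈A j)

    f-high : ∀ l q → to f (at (wʳ l) q) ≡ at (wʳ l) q
    f-high l q = translate-∉ A? q (high∉A l)

    -- x_w sends residue `wˡ j` to `j ↑ˡ m` and raises the quotient; w then restores the residue. On
    -- the high side the quotient stays.
    x·w≈translate : x k w · extend w ≈ f
    x·w≈translate a = subst (λ a → to (x k w · extend w) a ≡ to f a) a≡ (lem (side {k} {m} (w ⟨$⟩ˡ residue a)))
      where
      q = quotient a
      a≡ : at (w ⟨$⟩ʳ (w ⟨$⟩ˡ residue a)) q ≡ a
      a≡ = trans (cong (λ r → at r q) (Perm.inverseʳ w)) (at-residue-quotient a)
      lem : ∀ {i} → Side {k} {m} i → to (x k w · extend w) (at (w ⟨$⟩ʳ i) q) ≡ to f (at (w ⟨$⟩ʳ i) q)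
      lem (low j)  = trans (cong (to (extend w)) (x-at-low j q))
        (trans (extend-at w _ _) (sym (f-low j q)))
      lem (high l) = trans (cong (to (extend w)) (x-at-high l q))
        (trans (extend-at w _ _) (sym (f-high l q)))

    -- Summed in the order given by w, the `k` low terms are each n and the others vanish.
    translate-inComponent : InComponent k f
    translate-inComponent = i/n≡k/1 _ k (k ℕ.+ m) (trans (ℤSum.sum-permute g w)
      (∑-low (+ (k ℕ.+ m)) (g ∘ (w ⟨$⟩ʳ_)) g-low g-high))
      where
      open ≡-Reasoning
      g : Fin (k ℕ.+ m) → ℤ
      g i = to f [ i ] ℤ.- [ i ]
      g-at : ∀ i → g i ≡ to f (at i 0ℤ) ℤ.- at i 0ℤ
      g-at i = cong (λ a → to f a ℤ.- a) ([]≡at-0 i)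
      g-low : ∀ j → g (wˡ j) ≡ + (k ℕ.+ m)
      g-low j = begin
        g (wˡ j)                                            ≡⟨ g-at (wˡ j) ⟩
        to f (at (wˡ j) 0ℤ) ℤ.- at (wˡ j) 0ℤ                ≡⟨ cong (ℤ._- at (wˡ j) 0ℤ) (trans (f-low j 0ℤ) (at-suc (wˡ j) 0ℤ)) ⟩
        at (wˡ j) 0ℤ ℤ.+ + (k ℕ.+ m) ℤ.- at (wˡ j) 0ℤ       ≡⟨ lem (at (wˡ j) 0ℤ) (+ (k ℕ.+ m)) ⟩
        + (k ℕ.+ m)                                         ∎
        where
        lem : ∀ a n → a ℤ.+ n ℤ.- a ≡ n
        lem = solve-∀
      g-high : ∀ l → g (wʳ l) ≡ 0ℤ
      g-high l = begin
        g (wʳ l)                              ≡⟨ g-at (wʳ l) ⟩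
        to f (at (wʳ l) 0ℤ) ℤ.- at (wʳ l) 0ℤ  ≡⟨ cong (ℤ._- at (wʳ l) 0ℤ) (f-high l 0ℤ) ⟩
        at (wʳ l) 0ℤ ℤ.- at (wʳ l) 0ℤ         ≡⟨ ℤ.+-inverseʳ (at (wʳ l) 0ℤ) ⟩
        0ℤ                                    ∎

    -- For a = w(j), the only b ≡ w(l) (mod n) with a < b < a + n has quotient
    -- 0 or 1, according to whether w(j) < w(l).
    inversions-translate : Σ (Fin k × Fin m) (λ _ → ⊤) ↔ Inversion f
    inversions-translate = inversions↔ f w c (λ _ _ → refl) sound complete
      where
      open ShiftLow f w w f-low f-high (λ _ _ → ℕ.<-asym) (λ _ _ → ℕ.<-asym)

      c : Fin k → Fin m → ℤ
      c j l = if does (wˡ j Fin.<? wʳ l) then 0ℤ else 1ℤ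

      c-< : ∀ j l → wˡ j Fin.< wʳ l → c j l ≡ 0ℤ
      c-< j l lt = cong (if_then 0ℤ else 1ℤ) (dec-true (wˡ j Fin.<? wʳ l) lt)

      c-> : ∀ j l → wʳ l Fin.< wˡ j → c j l ≡ 1ℤ
      c-> j l gt = cong (if_then 0ℤ else 1ℤ) (dec-false (wˡ j Fin.<? wʳ l) (ℕ.<-asym gt))

      IsInversion : Fin k → Fin m → ℤ → Set
      IsInversion j l q = at (wˡ j) 0ℤ ℤ.< at (wʳ l) q × to f (at (wʳ l) q) ℤ.< to f (at (wˡ j) 0ℤ)

      sound : ∀ j l → ⊤ → IsInversion j l (c j l)
      sound j l _ with Fin.<-cmp (wˡ j) (wʳ l)
      ... | tri< lt _ _ = subst (IsInversion j l) (sym (c-< j l lt))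
        (at-mono-<ˡ 0ℤ lt , f-inverts-0 j l)
      ... | tri≈ _ eq _ = contradiction eq (wˡ≢wʳ j l)
      ... | tri> _ _ gt = subst (IsInversion j l) (sym (c-> j l gt))
        (at-mono-<ʳ _ _ (ℤ.+<+ ℕ.z<s) , f-inverts-1 j l gt)

      complete : ∀ p r q → at (w ⟨$⟩ʳ p) 0ℤ ℤ.< at (w ⟨$⟩ʳ r) q →
                 to f (at (w ⟨$⟩ʳ r) q) ℤ.< to f (at (w ⟨$⟩ʳ p) 0ℤ) →
                 ∃₂ λ j l → ⊤ × j ↑ˡ m ≡ p × k ↑ʳ l ≡ r × c j l ≡ q
      complete p r q lt gt with classify p r q lt gt
      ... | j , l , refl , refl , inj₁ (q≡0 , p<r) = j , l , tt , refl , refl , trans (c-< j l p<r) (sym q≡0)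
      ... | j , l , refl , refl , inj₂ (q≡1 , r<p) = j , l , tt , refl , refl , trans (c-> j l r<p) (sym q≡1)

    translate-hasLength : HasLength f (k * m)
    translate-hasLength = ↔-sym Fin.*↔× ↔-∘
      (mk↔ₛ′ proj₁ (_, tt) (λ _ → refl) (λ _ → refl) ↔-∘ ↔-sym inversions-translate)

-- The concatenated word

-- The equation is a hypothesis so that matching it with `refl` turns n into `k ℕ.+ m`, where
-- indices split into low and high.
reduced-word-translate : ∀ {n} k m .{{_ : NonTrivial n}} → k ℕ.+ m ≡ n →
  (w : Permutation′ n) → IsGrassmannian k w →
  {A : Pred (Fin n) 0ℓ} (A? : Decidable A) → A ≐ image w k →
  (word-x word-w : List (Fin n)) →
  IsReducedWord k (x k w) word-x →
  IsReducedWord 0 (extend w) word-w →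
  (x k w · extend w ≈ translate A?)
  × IsReducedWord k (translate A?) (word-x ++ word-w)
  × length (word-x ++ word-w) ≡ k * m
reduced-word-translate k m refl w grassmannian A? A≐image word-x word-w red-x red-w =
  x·w≈τ , record
    { inComponent = translate-inComponent w A? A≐image
    ; factorises  = factorises
    ; reduced     = subst (HasLength (translate A?)) (sym length≡) (translate-hasLength w A? A≐image)
    } , length≡
  where
  module X = IsReducedWord red-x
  module W = IsReducedWord red-w
  open ≡-Reasoning

  x·w≈τ : x k w · extend w ≈ translate A?
  x·w≈τ = x·w≈translate w A? A≐image

  length≡ : length (word-x ++ word-w) ≡ k * m
  length≡ = trans (length-++ word-x) (lengths-sum w grassmannian X.reduced W.reduced)

  factorises : ⟦ word-x ++ word-w ⟧ ≈ (Λ ⁻¹) ^ k · translate A?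
  factorises i = begin
    to ⟦ word-x ++ word-w ⟧ i                             ≡⟨ ⟦⟧-++ word-x word-w i ⟩
    -- For w the power of `Λ ⁻¹` is the zeroth, which vanishes by computation, so only the power
    -- from x_w remains.
    to ⟦ word-w ⟧ (to ⟦ word-x ⟧ i)                       ≡⟨ W.factorises _ ⟩
    to (extend w) (to ⟦ word-x ⟧ i)                       ≡⟨ cong (to (extend w)) (X.factorises i) ⟩
    to (x k w · extend w) (to ((Λ ⁻¹) ^ k) i)             ≡⟨ x·w≈τ _ ⟩
    to (translate A?) (to ((Λ ⁻¹) ^ k) i)                 ∎

lemma3p11 : ∀ (n k : ℕ) .{{_ : NonTrivial n}} → k ≤ n →
    (w : Permutation′ n) → IsGrassmannian k w →
    (P : LatticePath k n) → UpSteps P ≐ image w k →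
    (word-x word-w : List (Fin n)) →
    IsReducedWord k (x k w) word-x →
    IsReducedWord 0 (extend w) word-w →
    (x k w · extend w ≈ τ-path P)
    × IsReducedWord k (τ-path P) (word-x ++ word-w)
    × length (word-x ++ word-w) ≡ k * (n ∸ k)
lemma3p11 n k k≤n w grassmannian P =
  reduced-word-translate k (n ∸ k) (ℕ.m+[n∸m]≡n k≤n) w grassmannian (upSteps? P)
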